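{- Let $E^{\mathrm{ce}}$ be an equivalence relation on $\omega$ extending $=^{\mathrm{ce}}$. If $=^{\mathrm{ce}}<_{\mathrm{Learn}}E^{\mathrm{ce}}$, then there is an order embedding $$\iota\colon(\mathcal{P}_{\mathrm{fin}}(2^{\omega}),\subseteq)\to(\mathcal{E}^{\mathrm{ce}},\leq)$$ such that: (i) $\iota(\emptyset)=[=^{\mathrm{ce}}]_{\equiv_{\mathrm{Learn}}}$; (ii) for every nonempty $P\in\mathcal{P}_{\mathrm{fin}}(2^{\omega})$, we have $\iota(P)<[E^{\mathrm{ce}}]_{\equiv_{\mathrm{Learn}}}$. In particular, $\mathsf{TLH}=(\mathcal{E}^{\mathrm{ce}},\leq)$ is atomless.
   Context: Fix a standard (acceptable) enumeration $(\varphi_e)_{e\in\omega}$ of the partial computable functions and let $W_e=\operatorname{dom}(\varphi_e)$. Write $e=^{\mathrm{ce}}e'$ iff $W_e=W_{e'}$. Let $\mathcal{R}^{\mathrm{ce}}$ be the set of all equivalence relations on $\omega$ extending $=^{\mathrm{ce}}$ (no definability or effectivity is assumed). An enumeration of a set $A$ is a surjection $\mu:\omega\to A$; $\mu[s]$ denotes the finite string $\mu(0),\dots,\mu(s-1)$. A learner is an arbitrary function $\mathbf{M}:\omega^{<\omega}\to\omega$ (no effectivity is assumed). For $E^{\mathrm{ce}}\in\mathcal{R}^{\mathrm{ce}}$, a family $\mathfrak{K}$ of nonempty c.e. sets is $E^{\mathrm{ce}}$-learnable if there is a learner $\mathbf{M}$ such that for every $e$ with $W_e\in\mathfrak{K}$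 and every enumeration $\mu$ of $W_e$ there is $i\in\omega$ with $i\mathrel{E^{\mathrm{ce}}}e$ and $\mathbf{M}(\mu[s])=i$ for all sufficiently large $s$. $E^{\mathrm{ce}}\leq_{\mathrm{Learn}}F^{\mathrm{ce}}$ means that every $E^{\mathrm{ce}}$-learnable family of nonempty c.e. sets is also $F^{\mathrm{ce}}$-learnable; $<_{\mathrm{Learn}}$ is the strict part of this preorder and $\equiv_{\mathrm{Learn}}$ is mutual reducibility. The tolerant learning hierarchy $\mathsf{TLH}$ is the poset $(\mathcal{E}^{\mathrm{ce}},\leq)$ where $\mathcal{E}^{\mathrm{ce}}=\mathcal{R}^{\mathrm{ce}}/{\equiv_{\mathrm{Learn}}}$ and $\leq$ is induced by $\leq_{\mathrm{Learn}}$; its bottom element is $[=^{\mathrm{ce}}]_{\equiv_{\mathrm{Learn}}}$. $\mathcal{P}_{\mathrm{fin}}(X)$ is the set of all finite subsets of $X$. In a poset with bottom $\bot$, an atom is an element $a>\bot$ such that there is no $b$ with $\bot<b<a$; the poset is atomless if it has no atoms. -}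

module Defs where

open import Data.Bool.Base using (Bool)
open import Data.Fin.Base using (Fin)
open import Data.List.Base using (List; applyUpTo)
import Data.List.Membership.Setoid as SetoidMembership
import Data.List.Relation.Binary.Subset.Setoid as SetoidSubset
open import Data.Nat.Base using (ℕ; suc; _<_; _≤_)
open import Data.Product.Base using (_×_; _,_; ∃-syntax; Σ-syntax)
open import Data.Vec.Base using (Vec; []; _∷_; lookup)
open import Data.Vec.Relation.Binary.Pointwise.Inductive using (Pointwise)
open import Function.Base using (id; _∘_)
open import Function.Bundles using (_⇔_)
open import Level using (Level; 0ℓ) renaming (suc to lsuc)
open import Relation.Binary.Bundles using (Poset; Setoid)
open import Relation.Binary.Core using (Rel)
open import Relation.Binary.Definitions using (_Respects_; Minimum; Reflexive; Transitive)
import Relation.Binary.Construct.Interior.Symmetric as SymmetricInterior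
open import Relation.Binary.Morphism.Structures using (IsOrderMonomorphism)
import Relation.Binary.Properties.Poset as PosetProperties
open import Relation.Binary.PropositionalEquality using (_≡_; _→-setoid_)
open import Relation.Binary.Structures using (IsEquivalence)
open import Relation.Nullary.Negation.Core using (¬_)
open import Relation.Unary using (Pred; _∈_; _≐_; Satisfiable)
open import Relation.Unary.Properties using (≐-refl; ≐-sym; ≐-trans)

data Rec : ℕ → Set where
  zeroᴿ : Rec 0
  sucᴿ  : Rec 1
  proj  : ∀ {n} → Fin n → Rec n
  comp  : ∀ {m n} → Rec m → Vec (Rec n) m → Rec n
  prec  : ∀ {n} → Rec n → Rec (suc (suc n)) → Rec (suc n)
  mu    : ∀ {n} → Rec (suc n) → Rec n

-- f [ xs ]⇓ y : the function computed by f is defined on xs, with value y.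

infix 4 _[_]⇓_

data _[_]⇓_ : ∀ {n} → Rec n → Vec ℕ n → ℕ → Set where
  zeroᴿ  : zeroᴿ [ [] ]⇓ 0
  sucᴿ   : ∀ {x} → sucᴿ [ x ∷ [] ]⇓ suc x
  proj   : ∀ {n} {xs : Vec ℕ n} (i : Fin n) → proj i [ xs ]⇓ lookup xs i
  comp   : ∀ {m n} {g : Rec m} {fs : Vec (Rec n) m} {xs : Vec ℕ n} {ys : Vec ℕ m} {z : ℕ} →
           Pointwise (λ f y → f [ xs ]⇓ y) fs ys →
           g [ ys ]⇓ z →
           comp g fs [ xs ]⇓ z
  prec-0 : ∀ {n} {f : Rec n} {g : Rec (suc (suc n))} {xs : Vec ℕ n} {y : ℕ} →
           f [ xs ]⇓ y →
           prec f g [ 0 ∷ xs ]⇓ y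
  prec-s : ∀ {n} {f : Rec n} {g : Rec (suc (suc n))} {xs : Vec ℕ n} {k y z : ℕ} →
           prec f g [ k ∷ xs ]⇓ y →
           g [ k ∷ y ∷ xs ]⇓ z →
           prec f g [ suc k ∷ xs ]⇓ z
  mu     : ∀ {n} {f : Rec (suc n)} {xs : Vec ℕ n} {k : ℕ} →
           (∀ {j} → j < k → ∃[ y ] (f [ j ∷ xs ]⇓ suc y)) →
           f [ k ∷ xs ]⇓ 0 →
           mu f [ xs ]⇓ k

-- Acceptability in the sense of Rogers: the enumeration theorem together with
-- the s-m-n theorem.  A numbering is given by its graph: φ e x y means that
-- φ_e(x) is defined and equal to y.

record AcceptableNumbering : Set₁ where
  field
    φ         : ℕ → ℕ → ℕ → Set
    universal : ∃[ u ] ∀ e x y → φ e x y ⇔ u [ e ∷ x ∷ [] ]⇓ y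
    smn       : (f : Rec 2) →
                Σ[ s ∈ (ℕ → ℕ) ] (∃[ c ] ∀ e → c [ e ∷ [] ]⇓ s e) ×
                                  (∀ e x y → φ (s e) x y ⇔ f [ e ∷ x ∷ [] ]⇓ y)

  W : ℕ → Pred ℕ 0ℓ
  W e x = ∃[ y ] φ e x y

module Atoms {c ℓ₁ ℓ₂ : Level} (P : Poset c ℓ₁ ℓ₂)
             (⊥ : Poset.Carrier P) (⊥-minimum : Minimum (Poset._≤_ P) ⊥) where

  open PosetProperties P renaming (_<_ to _⊏_)

  IsAtom : Poset.Carrier P → Set _
  IsAtom a = (⊥ ⊏ a) × ¬ (∃[ b ] (⊥ ⊏ b) × (b ⊏ a))

  Atomless : Set _
  Atomless = ¬ (∃[ a ] IsAtom a)

OrderEmbedding : ∀ {a ℓ₁ ℓ₂ b ℓ₃ ℓ₄} (P : Poset a ℓ₁ ℓ₂) (Q : Poset b ℓ₃ ℓ₄) →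
                 (Poset.Carrier P → Poset.Carrier Q) → Set _
OrderEmbedding P Q = IsOrderMonomorphism (Poset._≈_ P) (Poset._≈_ Q) (Poset._≤_ P) (Poset._≤_ Q)

-- 2^ω is the set ℕ → Bool under pointwise equality.  A finite subset is given
-- by a list of its elements; lists with the same elements are identified by
-- the equality of the poset 𝒫fin.

Cantor : Setoid 0ℓ 0ℓ
Cantor = ℕ →-setoid Bool

FinSubset : Set
FinSubset = List (ℕ → Bool)

open SetoidMembership Cantor public using () renaming (_∈_ to _∈fin_)
open SetoidSubset Cantor public using () renaming (_⊆_ to _⊆fin_)

𝒫fin : Poset 0ℓ 0ℓ 0ℓ
𝒫fin = SymmetricInterior.poset {R = _⊆fin_} id (λ P⊆Q Q⊆R → Q⊆R ∘ P⊆Q)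

record Enumerates (μ : ℕ → ℕ) (A : Pred ℕ 0ℓ) : Set where
  field
    into : ∀ n → μ n ∈ A
    onto : ∀ {x} → x ∈ A → ∃[ n ] μ n ≡ x

Learner : Set
Learner = List ℕ → ℕ

module TolerantLearning (N : AcceptableNumbering) where

  open AcceptableNumbering N

  record ℛᶜᵉ : Set₁ where
    field
      _∼_           : Rel ℕ 0ℓ
      isEquivalence : IsEquivalence _∼_
      extends       : ∀ {i j} → W i ≐ W j → i ∼ j

  open ℛᶜᵉ using (_∼_; extends)

  =ᶜᵉ : ℛᶜᵉ
  =ᶜᵉ = record
    { _∼_           = λ i j → W i ≐ W j
    ; isEquivalence = record { refl = ≐-refl ; sym = ≐-sym ; trans = ≐-trans }
    ; extends       = id
    }

  record Family : Set₁ where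
    field
      members  : Pred (Pred ℕ 0ℓ) 0ℓ
      respects : members Respects _≐_
      ce       : ∀ {A} → A ∈ members → ∃[ e ] A ≐ W e
      nonempty : ∀ {A} → A ∈ members → Satisfiable A

  open Family using (members)

  -- applyUpTo μ s is the string μ(0),…,μ(s-1).

  Learns : ℛᶜᵉ → Family → Learner → Set
  Learns E 𝔎 M =
    ∀ e → W e ∈ members 𝔎 → ∀ μ → Enumerates μ (W e) →
    ∃[ i ] _∼_ E i e × (∃[ s₀ ] ∀ s → s₀ ≤ s → M (applyUpTo μ s) ≡ i)

  Learnable : ℛᶜᵉ → Family → Set
  Learnable E 𝔎 = ∃[ M ] Learns E 𝔎 M

  infix 4 _≤Learn_ _<Learn_

  _≤Learn_ : Rel ℛᶜᵉ (lsuc 0ℓ)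
  E ≤Learn F = ∀ 𝔎 → Learnable E 𝔎 → Learnable F 𝔎

  _<Learn_ : Rel ℛᶜᵉ (lsuc 0ℓ)
  E <Learn F = (E ≤Learn F) × ¬ (F ≤Learn E)

  ≤Learn-refl : Reflexive _≤Learn_
  ≤Learn-refl 𝔎 = id

  ≤Learn-trans : Transitive _≤Learn_
  ≤Learn-trans E≤F F≤G 𝔎 = F≤G 𝔎 ∘ E≤F 𝔎

  -- The quotient of ℛᶜᵉ by ≡Learn: the carrier is ℛᶜᵉ and the equality is
  -- mutual reducibility, so E stands for its own class.

  TLH : Poset (lsuc 0ℓ) (lsuc 0ℓ) (lsuc 0ℓ)
  TLH = SymmetricInterior.poset {R = _≤Learn_}
          (λ {E} → ≤Learn-refl {E}) (λ {E} {F} {G} → ≤Learn-trans {E} {F} {G})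

  =ᶜᵉ-minimum : Minimum _≤Learn_ =ᶜᵉ
  =ᶜᵉ-minimum E 𝔎 (M , learns) = M , λ e We∈𝔎 μ enum →
    let i , Wi≐We , converges = learns e We∈𝔎 μ enum
    in i , extends E Wi≐We , converges

  open Poset TLH public using () renaming (_≈_ to _≡Learn_)
  open PosetProperties TLH public using () renaming (_<_ to _<TLH_)
  open Atoms TLH =ᶜᵉ =ᶜᵉ-minimum public using () renaming (Atomless to TLH-Atomless)

{-# OPTIONS --safe #-}

-- By a locking-sequence argument, a family is E-learnable iff every member A
-- has a finite telltale D such that the members B with D ⊆ B ⊆ A are
-- E-equivalent to A.  It follows that E ≤Learn F iff for every c.e. set A, all
-- c.e. sets B ⊆ A that agree with A on a large enough initial segment and are
-- E-equivalent to A are also F-equivalent to A.  If E is not reducible to =ᶜᵉ,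
-- this fails for some A, which is then the limit of pairwise distinct c.e. sets
-- B₀, B₁, … ⊊ A in the E-class of A.  For X ⊆ ω let E_X collapse A with the Bₙ
-- for n ∈ X and nothing else.  Then E_X ≤Learn E, and E_X ≤Learn E_Y implies
-- that X ∖ Y is finite.  Taking for X the codes of the finite prefixes of the
-- elements of P turns inclusion of finite P ⊆ 2^ω into ≤Learn, because distinct
-- elements of 2^ω have only finitely many prefixes in common.

module Submission where

open import Defs
open import Axiom.ExcludedMiddle using (ExcludedMiddle)
open import Data.Bool.Base using (Bool; true; false; not)
open import Data.Bool.Properties using (not-¬)
open import Data.List.Base using (List; []; _∷_; _++_; length; applyUpTo; map)
open import Data.List.Membership.Propositional using () renaming (_∈_ to _∈ˡ_)
open import Data.List.Membership.Propositional.Properties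
  using (∈-applyUpTo⁺; ∈-applyUpTo⁻; ∈-++⁺ʳ)
open import Data.List.Properties using (++-assoc; ++-identityʳ; length-++; length-map)
open import Data.List.Relation.Unary.All as All using (All; []; _∷_)
open import Data.List.Relation.Unary.All.Properties as Allₚ using (++⁺)
open import Data.List.Relation.Unary.Any using (here; there)
open import Data.List.Relation.Unary.Any.Properties using (gmap)
open import Data.Nat.Base using (ℕ; zero; suc; _+_; _∸_; _⊔_; _≤_; _<_; z≤n; s≤s; s≤s⁻¹)
open import Data.Nat.Binary.Base using (ℕᵇ; zero; 2[1+_]; 1+[2_]; toℕ)
open import Data.Nat.Binary.Properties using (toℕ-injective)
open import Data.Nat.Induction using (<-rec)
open import Data.Nat.Properties
open import Data.Product.Base using (_×_; _,_; ∃-syntax; Σ-syntax; proj₁; proj₂)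
open import Data.Sum.Base using (_⊎_; inj₁; inj₂; [_,_]′)
open import Function.Base using (id; _∘_)
open import Level using (0ℓ; lift; lower) renaming (suc to lsuc)
open import Relation.Binary.Construct.Interior.Symmetric using (_,_)
open import Relation.Binary.Definitions using (tri<; tri≈; tri>)
open import Relation.Binary.Morphism.Structures using (IsOrderMonomorphism)
open import Relation.Binary.PropositionalEquality
  using (_≡_; refl; sym; trans; cong; cong₂; subst; module ≡-Reasoning)
open import Relation.Binary.Structures using (IsEquivalence)
open import Relation.Nullary.Decidable.Core using (yes; no; map′; decidable-stable)
open import Relation.Nullary.Negation.Core using (¬_; contradiction)
open import Relation.Unary using (Pred; _∈_; _∉_; _⊆_; _≐_; Satisfiable)
open import Relation.Unary.Properties using (≐-refl; ≐-sym; ≐-trans)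

-- Inclusion up to a bound, eventual truth, least witnesses

infix 4 _⊆⟨_⟩_

_⊆⟨_⟩_ : Pred ℕ 0ℓ → ℕ → Pred ℕ 0ℓ → Set
A ⊆⟨ N ⟩ B = ∀ {x} → x < N → x ∈ A → x ∈ B

⊆⟨⟩-antimono : ∀ {A B M N} → M ≤ N → A ⊆⟨ N ⟩ B → A ⊆⟨ M ⟩ B
⊆⟨⟩-antimono M≤N A⊆B x<M = A⊆B (<-≤-trans x<M M≤N)

Eventually : Pred ℕ 0ℓ → Set
Eventually P = ∃[ s₀ ] ∀ s → s₀ ≤ s → P s

eventually-× : ∀ {P Q} → Eventually P → Eventually Q → Eventually (λ s → P s × Q s)
eventually-× (a , p) (b , q) = a ⊔ b , λ s a⊔b≤s →
  p s (≤-trans (m≤m⊔n a b) a⊔b≤s) , q s (≤-trans (m≤n⊔m a b) a⊔b≤s)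

eventually-∀< : ∀ (P : ℕ → Pred ℕ 0ℓ) n → (∀ k → k < n → Eventually (P k)) →
                Eventually (λ s → ∀ {k} → k < n → P k s)
eventually-∀< P zero    _   = 0 , λ _ _ ()
eventually-∀< P (suc n) evs
  with s₀ , p ← eventually-× (evs n ≤-refl)
                             (eventually-∀< P n (λ k k<n → evs k (m<n⇒m<1+n k<n)))
  = s₀ , λ s s₀≤s k<1+n → [ (λ k<n → proj₂ (p s s₀≤s) k<n)
                          , (λ { refl → proj₁ (p s s₀≤s) }) ]′ (m≤n⇒m<n∨m≡n (s≤s⁻¹ k<1+n))

Least : Pred ℕ 0ℓ → Pred ℕ 0ℓ
Least P m = P m × (∀ {k} → k < m → ¬ P k)

least-unique : ∀ {P m n} → Least P m → Least P n → m ≡ n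
least-unique {m = m} {n} (Pm , <m) (Pn , <n) with <-cmp m n
... | tri< m<n _ _ = contradiction Pm (<n m<n)
... | tri≈ _ m≡n _ = m≡n
... | tri> _ _ n<m = contradiction Pn (<m n<m)

bounded : ∀ xs → ∃[ N ] All (_< N) xs
bounded []       = 0 , []
bounded (x ∷ xs) with N , xs<N ← bounded xs =
  suc x ⊔ N , m≤m⊔n (suc x) N ∷ All.map (λ y<N → ≤-trans y<N (m≤n⊔m (suc x) N)) xs<N

-- Strings and their limits

-- Junk value 0 past the end of the list.
nth : List ℕ → ℕ → ℕ
nth []       _       = 0
nth (x ∷ xs) zero    = x
nth (x ∷ xs) (suc i) = nth xs i

nth-++ˡ : ∀ xs ys {i} → i < length xs → nth (xs ++ ys) i ≡ nth xs i
nth-++ˡ (x ∷ xs) ys {zero}  _         = refl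
nth-++ˡ (x ∷ xs) ys {suc i} (s≤s i<n) = nth-++ˡ xs ys i<n

applyUpTo-nth : ∀ {f} xs → (∀ {i} → i < length xs → f i ≡ nth xs i) →
                applyUpTo f (length xs) ≡ xs
applyUpTo-nth []       _  = refl
applyUpTo-nth (x ∷ xs) eq = cong₂ _∷_ (eq (s≤s z≤n)) (applyUpTo-nth xs (eq ∘ s≤s))

module Limit (L : ℕ → List ℕ) (x : ℕ → ℕ) (t : ℕ → List ℕ)
             (grows : ∀ n → L (suc n) ≡ L n ++ x n ∷ t n) where

  -- `L (suc i)` has length at least `suc i`, so the junk value of `nth` is never read.
  limit : ℕ → ℕ
  limit i = nth (L (suc i)) i

  n≤length : ∀ n → n ≤ length (L n)
  n≤length zero    = z≤n
  n≤length (suc n) = begin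
    suc n                             ≤⟨ s≤s (n≤length n) ⟩
    suc (length (L n))                ≤⟨ s≤s (m≤m+n _ _) ⟩
    suc (length (L n) + length (t n)) ≡⟨ +-suc _ _ ⟨
    length (L n) + suc (length (t n)) ≡⟨ length-++ (L n) ⟨
    length (L n ++ x n ∷ t n)         ≡⟨ cong length (grows n) ⟨
    length (L (suc n))                ∎
    where open ≤-Reasoning

  extension : ∀ m k → ∃[ r ] L (k + m) ≡ L m ++ r
  extension m zero    = [] , sym (++-identityʳ (L m))
  extension m (suc k) with r , eq ← extension m k =
    r ++ x (k + m) ∷ t (k + m) ,
    trans (grows (k + m)) (trans (cong (_++ x (k + m) ∷ t (k + m)) eq) (++-assoc (L m) r _))

  nth-stable : ∀ {m n i} → m ≤ n → i < length (L m) → nth (L n) i ≡ nth (L m) i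
  nth-stable {m} {n} {i} m≤n i<m with r , eq ← extension m (n ∸ m) =
    trans (cong (λ l → nth l i) (trans (cong L (sym (m∸n+n≡m m≤n))) eq)) (nth-++ˡ (L m) r i<m)

  -- One of `L (suc i)` and `L n` extends the other, and position `i` already lies in the shorter
  -- one.
  limit-prefix : ∀ n → applyUpTo limit (length (L n)) ≡ L n
  limit-prefix n = applyUpTo-nth (L n) λ {i} i<n →
    [ (λ 1+i≤n → sym (nth-stable 1+i≤n (n≤length (suc i))))
    , (λ n≤1+i → nth-stable n≤1+i i<n) ]′ (≤-total (suc i) n)

infixr 4 _⧺_

_⧺_ : List ℕ → (ℕ → ℕ) → ℕ → ℕ
([]     ⧺ μ) i       = μ i
(x ∷ σ ⧺ μ)  zero    = x
(x ∷ σ ⧺ μ)  (suc i) = (σ ⧺ μ) i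

applyUpTo-⧺ : ∀ σ μ s → applyUpTo (σ ⧺ μ) (length σ + s) ≡ σ ++ applyUpTo μ s
applyUpTo-⧺ []      μ s = refl
applyUpTo-⧺ (x ∷ σ) μ s = cong (x ∷_) (applyUpTo-⧺ σ μ s)

⧺-enumerates : ∀ {A σ μ} → All A σ → Enumerates μ A → Enumerates (σ ⧺ μ) A
⧺-enumerates {A} {σ} {μ} σ⊆A e = record { into = into′ σ⊆A ; onto = onto′ σ ∘ onto }
  where
  open Enumerates e
  into′ : ∀ {σ} → All A σ → ∀ n → (σ ⧺ μ) n ∈ A
  into′ []        n       = into n
  into′ (x∈A ∷ _) zero    = x∈A
  into′ (_ ∷ σ⊆A) (suc n) = into′ σ⊆A n
  onto′ : ∀ σ {x} → ∃[ n ] μ n ≡ x → ∃[ n ] (σ ⧺ μ) n ≡ x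
  onto′ []      p = p
  onto′ (y ∷ σ) p with n , eq ← onto′ σ p = suc n , eq

-- Codes of the finite prefixes of a point of 2^ω

prefix : (ℕ → Bool) → ℕ → ℕᵇ
prefix x zero    = zero
prefix x (suc k) with x 0
... | true  = 2[1+ prefix (x ∘ suc) k ]
... | false = 1+[2 prefix (x ∘ suc) k ]

prefix-agree : ∀ x y k l → prefix x k ≡ prefix y l → ∀ {i} → i < k → x i ≡ y i
prefix-agree x y (suc k) zero eq with x 0
prefix-agree x y (suc k) zero () | true
prefix-agree x y (suc k) zero () | false
prefix-agree x y (suc k) (suc l) eq {i} i<k with x 0 in x₀ | y 0 in y₀
prefix-agree x y (suc k) (suc l) eq {zero}  _ | true  | true  = trans x₀ (sym y₀)
prefix-agree x y (suc k) (suc l) eq {zero}  _ | false | false = trans x₀ (sym y₀)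
prefix-agree x y (suc k) (suc l) eq {suc i} (s≤s i<k) | true  | true  =
  prefix-agree (x ∘ suc) (y ∘ suc) k l (2[1+]-inj eq) i<k
  where
  2[1+]-inj : ∀ {a b} → 2[1+ a ] ≡ 2[1+ b ] → a ≡ b
  2[1+]-inj refl = refl
prefix-agree x y (suc k) (suc l) eq {suc i} (s≤s i<k) | false | false =
  prefix-agree (x ∘ suc) (y ∘ suc) k l (1+[2]-inj eq) i<k
  where
  1+[2]-inj : ∀ {a b} → 1+[2 a ] ≡ 1+[2 b ] → a ≡ b
  1+[2]-inj refl = refl

-- The constructors `2[1+_]` and `1+[2_]` are the two digits of bijective base 2, so the number
-- determines the prefix, including its length.
code : (ℕ → Bool) → ℕ → ℕ
code x k = toℕ (prefix x k)

-- Long prefixes have large codes, so a statement about almost all codes still covers them.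
k≤code : ∀ x k → k ≤ code x k
k≤code x zero = z≤n
k≤code x (suc k) with x 0
... | true  = ≤-trans (s≤s (k≤code (x ∘ suc) k)) (m≤m+n _ _)
... | false = s≤s (≤-trans (k≤code (x ∘ suc) k) (m≤m+n _ _))

Codes : FinSubset → Pred ℕ 0ℓ
Codes P n = ∃[ y ] (y ∈fin P) × (∃[ k ] n ≡ code y k)

Codes-mono : ∀ {P Q} → P ⊆fin Q → Codes P ⊆ Codes Q
Codes-mono P⊆Q (y , y∈P , k) = y , P⊆Q y∈P , k

-- A point outside a finite subset of 2^ω

diagonal : FinSubset → ℕ → Bool
diagonal []      _       = true
diagonal (y ∷ P) zero    = not (y 0)
diagonal (y ∷ P) (suc i) = diagonal (map (_∘ suc) P) i

diagonal-∉ : ∀ P → ¬ (diagonal P ∈fin P)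
diagonal-∉ P = go (length P) P refl
  where
  -- The recursion is on the length, since `map (_∘ suc) P` is not a subterm of `y ∷ P`.
  go : ∀ n P → n ≡ length P → ¬ (diagonal P ∈fin P)
  go _       (y ∷ P) _  (here d≗y)  = not-¬ refl (sym (d≗y 0))
  go (suc n) (y ∷ P) eq (there d∈P) =
    go n (map (_∘ suc) P) (trans (suc-injective eq) (sym (length-map _ P)))
       (gmap (λ d≗z i → d≗z (suc i)) d∈P)

-- Classical principles and locking sequences

module Classical (em : ExcludedMiddle 0ℓ) where

  dne : ∀ {P : Set} → ¬ ¬ P → P
  dne = decidable-stable em

  least-exists : ∀ {P : Pred ℕ 0ℓ} n → P n → ∃[ m ] Least P m
  least-exists {P} = <-rec (λ n → P n → ∃[ m ] Least P m) step
    where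
    step : ∀ n → (∀ {k} → k < n → P k → ∃[ m ] Least P m) → P n → ∃[ m ] Least P m
    step n ih Pn with em {∃[ k ] k < n × P k}
    ... | yes (k , k<n , Pk) = ih k<n Pk
    ... | no ∄k              = n , Pn , λ k<n Pk → ∄k (_ , k<n , Pk)

  -- Excluded middle decides `A`: each element is listed at its own position, and `a` fills the
  -- others.
  enumeration : ∀ {A : Pred ℕ 0ℓ} → Satisfiable A → ∃[ μ ] Enumerates μ A
  enumeration {A} (a , a∈A) = μ , record { into = into ; onto = λ {x} x∈A → x , onto x∈A }
    where
    μ : ℕ → ℕ
    μ n with em {A n}
    ... | yes _ = n
    ... | no  _ = a
    into : ∀ n → μ n ∈ A
    into n with em {A n}
    ... | yes n∈A = n∈A
    ... | no  _   = a∈A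
    onto : ∀ {n} → n ∈ A → μ n ≡ n
    onto {n} n∈A with em {A n}
    ... | yes _  = refl
    ... | no n∉A = contradiction n∈A n∉A

  module _ (M : Learner) {A : Pred ℕ 0ℓ} where

    -- Only extensions that continue with `x` are constrained. When this fails throughout, a
    -- prescribed element can be inserted before each change of guess, which keeps the limit onto
    -- `A`.
    Locking : List ℕ → ℕ → Set
    Locking σ x = ∀ τ → All A τ → M (σ ++ x ∷ τ) ≡ M σ

    -- Appending ν 0, ν 1, … in turn, each followed by a suffix that changes the
    -- guess of M, produces in the limit an enumeration of A on which M diverges.
    module Unlocked
      (unlocked : ¬ (∃[ σ ] ∃[ x ] All A σ × x ∈ A × Locking σ x))
      {ν : ℕ → ℕ} (ν-enum : Enumerates ν A) where

      module ν = Enumerates ν-enum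

      change : ∀ {σ} → All A σ → ∀ n → ∃[ τ ] All A τ × ¬ (M (σ ++ ν n ∷ τ) ≡ M σ)
      change {σ} σ⊆A n = dne λ none → unlocked
        (σ , ν n , σ⊆A , ν.into n , λ τ τ⊆A → dne λ M≢ → none (τ , τ⊆A , M≢))

      string : ∀ (n : ℕ) → Σ[ σ ∈ List ℕ ] All A σ
      string zero    = [] , []
      string (suc n) = let σ , σ⊆A = string n
                           τ , τ⊆A , _ = change σ⊆A n
                       in σ ++ ν n ∷ τ , ++⁺ σ⊆A (ν.into n ∷ τ⊆A)

      L : ℕ → List ℕ
      L n = proj₁ (string n)

      suffix : ℕ → List ℕ
      suffix n = proj₁ (change (proj₂ (string n)) n)

      L-grows : ∀ n → L (suc n) ≡ L n ++ ν n ∷ suffix n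
      L-grows n = refl

      module Lim = Limit L ν suffix L-grows

      limit-enumerates : Enumerates Lim.limit A
      limit-enumerates = record
        { into = λ i → All.lookup
            (subst (All A) (sym (Lim.limit-prefix (suc i))) (proj₂ (string (suc i))))
            (∈-applyUpTo⁺ Lim.limit (Lim.n≤length (suc i)))
        ; onto = λ x∈A → let n , νn≡x = ν.onto x∈A
                             i , _ , νn≡limit = ∈-applyUpTo⁻ Lim.limit
                               (subst (ν n ∈ˡ_) (sym (Lim.limit-prefix (suc n)))
                                      (∈-++⁺ʳ (L n) (here refl)))
                         in i , trans (sym νn≡limit) νn≡x
        }

      -- The limit passes through `L s₀` and `L (suc s₀)`, both of length at least `s₀`, and
      -- `change` makes the guesses on them differ.
      diverges : ∀ {i} → ¬ Eventually (λ s → M (applyUpTo Lim.limit s) ≡ i)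
      diverges {i} (s₀ , M≡i) = proj₂ (proj₂ (change (proj₂ (string s₀)) s₀))
        (trans (guess (suc s₀) (n≤1+n s₀)) (sym (guess s₀ ≤-refl)))
        where
        guess : ∀ n → s₀ ≤ n → M (L n) ≡ i
        guess n s₀≤n = trans (cong M (sym (Lim.limit-prefix n)))
                             (M≡i _ (≤-trans s₀≤n (Lim.n≤length n)))

    locking-sequence : Satisfiable A →
      (∀ μ → Enumerates μ A → ∃[ i ] Eventually (λ s → M (applyUpTo μ s) ≡ i)) →
      ∃[ σ ] ∃[ x ] All A σ × x ∈ A × Locking σ x
    locking-sequence A≠∅ converges = dne λ unlocked →
      let ν , ν-enum = enumeration A≠∅
          open Unlocked unlocked ν-enum
      in diverges (proj₂ (converges Lim.limit limit-enumerates))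

  module Reducibility (N : AcceptableNumbering) where

    open AcceptableNumbering N using (W)
    open TolerantLearning N
    open ℛᶜᵉ using (isEquivalence; extends)
    open Family using (members; nonempty)

    -- Telltales and learnability

    infix 4 _∼[_]_
    _∼[_]_ : ℕ → ℛᶜᵉ → ℕ → Set
    i ∼[ E ] j = ℛᶜᵉ._∼_ E i j

    -- Angluin's telltale condition up to `E`; the finite telltale is the part of `W e` below `n`.
    Telltale : ℛᶜᵉ → Family → ℕ → Set
    Telltale E 𝔎 e = ∃[ n ] ∀ b → W b ∈ members 𝔎 → W b ⊆ W e → W e ⊆⟨ n ⟩ W b → b ∼[ E ] e

    -- Let `n` bound `σ` and `x`. An enumeration of `W b` that begins with `σ` and `x` stays inside
    -- `W e`, so `M` keeps the guess `M σ` on it. Thus `M σ` is correct for `b` and for `e` alike.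
    locked⇒telltale : ∀ E 𝔎 M → Learns E 𝔎 M → ∀ e → W e ∈ members 𝔎 →
      ∀ σ x → All (W e) σ → x ∈ W e → Locking M {W e} σ x → Telltale E 𝔎 e
    locked⇒telltale E 𝔎 M learns e We∈𝔎 σ x σ⊆We x∈We lock
      with n , x<n ∷ σ<n ← bounded (x ∷ σ)
      = n , λ b Wb∈𝔎 Wb⊆We We⊆Wb →
          ∼.trans (∼.sym (guess b Wb∈𝔎 Wb⊆We
                           (All.zipWith (λ (y<n , y∈We) → We⊆Wb y<n y∈We) (σ<n , σ⊆We))
                           (We⊆Wb x<n x∈We)))
                  (guess e We∈𝔎 id σ⊆We x∈We)
      where
      module ∼ = IsEquivalence (isEquivalence E)
      guess : ∀ b → W b ∈ members 𝔎 → W b ⊆ W e → All (W b) σ → x ∈ W b → M σ ∼[ E ] b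
      guess b Wb∈𝔎 Wb⊆We σ⊆Wb x∈Wb
        with μ , enum ← enumeration (nonempty 𝔎 Wb∈𝔎)
        with i , i∼b , s₀ , M≡i ← learns b Wb∈𝔎 (σ ⧺ (x ∷ []) ⧺ μ)
               (⧺-enumerates σ⊆Wb (⧺-enumerates (x∈Wb ∷ []) enum))
        = subst (_∼[ E ] b) (sym Mσ≡i) i∼b
        where
        Mσ≡i : M σ ≡ i
        Mσ≡i = begin
          M σ
            ≡⟨ lock _ (All.map Wb⊆We (Allₚ.applyUpTo⁺₂ μ s₀ (Enumerates.into enum))) ⟨
          M (σ ++ x ∷ applyUpTo μ s₀)
            ≡⟨ cong M (applyUpTo-⧺ σ ((x ∷ []) ⧺ μ) (suc s₀)) ⟨
          M (applyUpTo (σ ⧺ (x ∷ []) ⧺ μ) (length σ + suc s₀))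
            ≡⟨ M≡i _ (≤-trans (n≤1+n s₀) (m≤n+m (suc s₀) (length σ))) ⟩
          i ∎
          where open ≡-Reasoning

    learnable⇒telltale : ∀ E 𝔎 → Learnable E 𝔎 → ∀ e → W e ∈ members 𝔎 → Telltale E 𝔎 e
    learnable⇒telltale E 𝔎 (M , learns) e We∈𝔎 =
      let σ , x , σ⊆We , x∈We , lock = locking-sequence M {W e} (nonempty 𝔎 We∈𝔎)
            λ μ enum → let i , _ , converges = learns e We∈𝔎 μ enum in i , converges
      in locked⇒telltale E 𝔎 M learns e We∈𝔎 σ x σ⊆We x∈We lock

    -- The learner guesses the least index that is compatible with the data.
    module _ (E : ℛᶜᵉ) (𝔎 : Family)
             (telltale : ∀ e → W e ∈ members 𝔎 → Telltale E 𝔎 e) where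

      Candidate : List ℕ → Pred ℕ 0ℓ
      Candidate σ e = Σ[ We∈𝔎 ∈ W e ∈ members 𝔎 ]
        All (W e) σ × W e ⊆⟨ proj₁ (telltale e We∈𝔎) ⟩ (_∈ˡ σ)

      leastCandidate : Learner
      leastCandidate σ with em {∃[ m ] Least (Candidate σ) m}
      ... | yes (m , _) = m
      -- A default: along an enumeration of a member, a least candidate exists from some stage on.
      ... | no  _       = 0

      leastCandidate-correct : ∀ σ {m} → Least (Candidate σ) m → leastCandidate σ ≡ m
      leastCandidate-correct σ {m} least with em {∃[ m ] Least (Candidate σ) m}
      ... | yes (m′ , least′) = least-unique {Candidate σ} least′ least
      ... | no  ∄m            = contradiction (m , least) ∄m

      telltale⇒learnable : Learnable E 𝔎
      telltale⇒learnable = leastCandidate , learns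
        where
        module ∼ = IsEquivalence (isEquivalence E)
        learns : Learns E 𝔎 leastCandidate
        -- `b` itself is a limit candidate, so there is a least one.
        learns b Wb∈𝔎 μ enum = convergence (least-exists b (Wb∈𝔎 , id , λ _ → id))
          where
          open Enumerates enum

          LimitCandidate : Pred ℕ 0ℓ
          LimitCandidate e = Σ[ We∈𝔎 ∈ W e ∈ members 𝔎 ]
            W b ⊆ W e × W e ⊆⟨ proj₁ (telltale e We∈𝔎) ⟩ W b

          seen : ∀ i → Eventually (λ s → μ i ∈ˡ applyUpTo μ s)
          seen i = suc i , λ s i<s → ∈-applyUpTo⁺ μ i<s

          eventually-accepted : ∀ {e} → LimitCandidate e →
                                Eventually (λ s → Candidate (applyUpTo μ s) e)
          eventually-accepted {e} (We∈𝔎 , Wb⊆We , We⊆Wb) =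
            let s₀ , p = eventually-∀< (λ x s → x ∈ W e → x ∈ˡ applyUpTo μ s)
                           (proj₁ (telltale e We∈𝔎)) shown
            in s₀ , λ s s₀≤s →
                 We∈𝔎 , Allₚ.applyUpTo⁺₂ μ s (λ i → Wb⊆We (into i)) , p s s₀≤s
            where
            shown : ∀ x → x < proj₁ (telltale e We∈𝔎) →
                    Eventually (λ s → x ∈ W e → x ∈ˡ applyUpTo μ s)
            shown x x<n with em {W e x}
            ... | no  x∉We = 0 , λ _ _ x∈We → contradiction x∈We x∉We
            ... | yes x∈We with i , refl ← onto (We⊆Wb x<n x∈We)
                           with s₀ , p ← seen i = s₀ , λ s s₀≤s _ → p s s₀≤s

          -- An element of `W b` outside `W e` refutes `e` once it is enumerated. Without such an
          -- element `e` fails at every stage, because the data lie in `W b`.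
          eventually-rejected : ∀ {e} → ¬ LimitCandidate e →
                                Eventually (λ s → ¬ Candidate (applyUpTo μ s) e)
          eventually-rejected {e} ¬lim with em {∃[ i ] ¬ W e (μ i)}
          ... | yes (i , μi∉We) with s₀ , p ← seen i =
            s₀ , λ s s₀≤s (_ , ⊆We , _) → μi∉We (All.lookup ⊆We (p s s₀≤s))
          ... | no ∄i = 0 , λ s _ (We∈𝔎 , _ , We⊆μ) → ¬lim
            ( We∈𝔎
            , (λ x∈Wb → let i , μi≡x = onto x∈Wb
                        in subst (W e) μi≡x (dne λ μi∉We → ∄i (i , μi∉We)))
            , (λ x<n x∈We → let i , _ , x≡μi = ∈-applyUpTo⁻ μ (We⊆μ x<n x∈We)
                            in subst (W b) (sym x≡μi) (into i)))

          convergence : ∃[ m ] Least LimitCandidate m →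
                        ∃[ i ] i ∼[ E ] b × Eventually (λ s → leastCandidate (applyUpTo μ s) ≡ i)
          convergence (m , lim@(Wm∈𝔎 , Wb⊆Wm , Wm⊆Wb) , <m)
            with s₀ , p ← eventually-×
                   (eventually-accepted lim)
                   (eventually-∀< (λ k s → ¬ Candidate (applyUpTo μ s) k) m
                     (λ k k<m → eventually-rejected (<m k<m)))
            -- `m` may index a larger set than `W b`, but `W b` contains the telltale of `m`, so the
            -- guess is right up to `E`.
            = m , ∼.sym (proj₂ (telltale m Wm∈𝔎) b Wb∈𝔎 Wb⊆Wm Wm⊆Wb)
                , s₀ , λ s s₀≤s → leastCandidate-correct (applyUpTo μ s) (p s s₀≤s)

    -- Reducibility as local refinement

    LocallyFiner : ℛᶜᵉ → ℛᶜᵉ → ℕ → Set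
    LocallyFiner E F e =
      ∃[ n ] ∀ b → W b ⊆ W e → W e ⊆⟨ n ⟩ W b → b ∼[ E ] e → b ∼[ F ] e

    locallyFiner⇒≤Learn : ∀ E F → (∀ e → LocallyFiner E F e) → E ≤Learn F
    locallyFiner⇒≤Learn E F finer 𝔎 learnable = telltale⇒learnable F 𝔎 λ e We∈𝔎 →
      let m , tell = learnable⇒telltale E 𝔎 learnable e We∈𝔎
          n , fine = finer e
      in m ⊔ n , λ b Wb∈𝔎 Wb⊆We We⊆Wb →
           fine b Wb⊆We (⊆⟨⟩-antimono {W e} {W b} (m≤n⊔m m n) We⊆Wb)
             (tell b Wb∈𝔎 Wb⊆We (⊆⟨⟩-antimono {W e} {W b} (m≤m⊔n m n) We⊆Wb))

    -- The nonempty sets in the E-class of e form a family that is E-learnable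
    -- by the constant guess e.
    ≤Learn⇒locallyFiner : ∀ E F → E ≤Learn F → ∀ e → LocallyFiner E F e
    ≤Learn⇒locallyFiner E F E≤F e with em {Satisfiable (W e)}
    -- The family below has only nonempty members, so an empty `W e` is treated apart.
    ... | no  We≡∅ = 0 , λ b Wb⊆We _ _ →
      extends F (Wb⊆We , λ x∈We → contradiction (_ , x∈We) We≡∅)
    -- The bound `suc x` puts `x` into `W b`, which is then nonempty and hence a member of `class`.
    ... | yes (x , x∈We) = suc x ⊔ n , λ b Wb⊆We We⊆Wb b∼e →
      tell b ((x , We⊆Wb (m≤m⊔n (suc x) n) x∈We) , b , ≐-refl , b∼e) Wb⊆We
        (⊆⟨⟩-antimono {W e} {W b} (m≤n⊔m (suc x) n) We⊆Wb)
      where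
      module ∼ = IsEquivalence (isEquivalence E)
      class : Family
      class = record
        { members  = λ A → Satisfiable A × (∃[ c ] A ≐ W c × c ∼[ E ] e)
        ; respects = λ A≐B ((y , y∈A) , c , A≐Wc , c∼e) →
                       (y , proj₁ A≐B y∈A) , c , ≐-trans (≐-sym A≐B) A≐Wc , c∼e
        ; ce       = λ (_ , c , A≐Wc , _) → c , A≐Wc
        ; nonempty = proj₁
        }
      learnable : Learnable E class
      learnable = (λ _ → e) , λ b (_ , c , Wb≐Wc , c∼e) _ _ →
        e , ∼.sym (∼.trans (extends E Wb≐Wc) c∼e) , 0 , λ _ _ → refl
      e-telltale : Telltale F class e
      e-telltale = learnable⇒telltale F class (E≤F class learnable) e
                     ((x , x∈We) , e , ≐-refl , ∼.refl)
      n : ℕ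
      n = proj₁ e-telltale
      tell : ∀ b → W b ∈ members class → W b ⊆ W e → W e ⊆⟨ n ⟩ W b → b ∼[ F ] e
      tell = proj₂ e-telltale

    refines⇒≤Learn : ∀ E F → (∀ {i j} → i ∼[ E ] j → i ∼[ F ] j) → E ≤Learn F
    refines⇒≤Learn E F E⊆F 𝔎 (M , learns) = M , λ e We∈𝔎 μ enum →
      let i , i∼e , converges = learns e We∈𝔎 μ enum in i , E⊆F i∼e , converges

    -- Proper subsets approximating a set within its class

    record Approximation (E : ℛᶜᵉ) (a n : ℕ) : Set where
      field
        index     : ℕ
        below     : W index ⊆ W a
        close     : W a ⊆⟨ n ⟩ W index
        related   : index ∼[ E ] a
        missing   : ℕ
        missing∈a : missing ∈ W a
        missing∉  : missing ∉ W index

    ¬locallyFiner⇒approximation : ∀ E a → ¬ LocallyFiner E =ᶜᵉ a → ∀ n → Approximation E a n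
    ¬locallyFiner⇒approximation E a coarse n = dne λ none →
      coarse (n , λ b Wb⊆Wa Wa⊆Wb b∼a → Wb⊆Wa , λ {x} x∈Wa → dne λ x∉Wb → none record
        { index = b ; below = Wb⊆Wa ; close = Wa⊆Wb ; related = b∼a
        ; missing = x ; missing∈a = x∈Wa ; missing∉ = x∉Wb })

    ≰=ᶜᵉ⇒approximable : ∀ E → ¬ (E ≤Learn =ᶜᵉ) → ∃[ a ] ∀ n → Approximation E a n
    ≰=ᶜᵉ⇒approximable E E≰= =
      let a , coarse = dne {∃[ e ] ¬ LocallyFiner E =ᶜᵉ e} λ none →
                         E≰= (locallyFiner⇒≤Learn E =ᶜᵉ λ e → dne λ coarse → none (e , coarse))
      in a , ¬locallyFiner⇒approximation E a coarse

    -- Collapsing a set with some of its approximations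

    glue : (C : Pred ℕ 0ℓ) → (∀ {i j} → W i ≐ W j → C i → C j) → ℛᶜᵉ
    glue C resp = record
      { _∼_           = λ i j → W i ≐ W j ⊎ C i × C j
      ; isEquivalence = record
        { refl  = inj₁ ≐-refl
        ; sym   = λ { (inj₁ i≐j) → inj₁ (≐-sym i≐j) ; (inj₂ (Ci , Cj)) → inj₂ (Cj , Ci) }
        ; trans = λ where
            (inj₁ i≐j)       (inj₁ j≐k)       → inj₁ (≐-trans i≐j j≐k)
            (inj₁ i≐j)       (inj₂ (Cj , Ck)) → inj₂ (resp (≐-sym i≐j) Cj , Ck)
            (inj₂ (Ci , Cj)) (inj₁ j≐k)       → inj₂ (Ci , resp j≐k Cj)
            (inj₂ (Ci , _))  (inj₂ (_ , Ck))  → inj₂ (Ci , Ck)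
        }
      ; extends       = inj₁
      }

    module Embedding (E : ℛᶜᵉ) (a : ℕ) (approximation : ∀ n → Approximation E a n) where

      module A n = Approximation (approximation n)

      -- Chosen so that B n contains the element of W a missed by B m, for m < n.
      bound : ℕ → ℕ
      bound zero    = 0
      bound (suc n) = suc (A.missing (bound n))

      module B n = A (bound n)

      bound≤missing : ∀ n → bound n ≤ B.missing n
      bound≤missing n = ≮⇒≥ λ missing<bound →
        B.missing∉ n (B.close n missing<bound (B.missing∈a n))

      bound-mono : ∀ {m n} → m ≤ n → bound m ≤ bound n
      bound-mono {m} {n} m≤n with m≤n⇒m<n∨m≡n m≤n
      ... | inj₂ refl = ≤-refl
      bound-mono {m} {suc n} _ | inj₁ (s≤s m≤n) =
        ≤-trans (bound-mono m≤n) (m≤n⇒m≤1+n (bound≤missing n))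

      n≤bound : ∀ n → n ≤ bound n
      n≤bound zero    = z≤n
      n≤bound (suc n) = s≤s (≤-trans (n≤bound n) (bound≤missing n))

      B≐̸a : ∀ n → ¬ (W (B.index n) ≐ W a)
      B≐̸a n (_ , a⊆B) = B.missing∉ n (a⊆B (B.missing∈a n))

      B-distinct : ∀ {m n} → m < n → ¬ (W (B.index m) ≐ W (B.index n))
      B-distinct {m} {n} m<n (_ , Bn⊆Bm) =
        B.missing∉ m (Bn⊆Bm (B.close n (bound-mono m<n) (B.missing∈a m)))

      B-injective : ∀ {m n} → W (B.index m) ≐ W (B.index n) → m ≡ n
      B-injective {m} {n} eq with <-cmp m n
      ... | tri< m<n _ _ = contradiction eq (B-distinct m<n)
      ... | tri≈ _ m≡n _ = m≡n
      ... | tri> _ _ n<m = contradiction (≐-sym eq) (B-distinct n<m)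

      Class : Pred ℕ 0ℓ → Pred ℕ 0ℓ
      Class X i = W i ≐ W a ⊎ (∃[ n ] X n × W i ≐ W (B.index n))

      collapse : Pred ℕ 0ℓ → ℛᶜᵉ
      collapse X = glue (Class X) λ where
        i≐j (inj₁ i≐a)            → inj₁ (≐-trans (≐-sym i≐j) i≐a)
        i≐j (inj₂ (n , Xn , i≐B)) → inj₂ (n , Xn , ≐-trans (≐-sym i≐j) i≐B)

      collapse-mono : ∀ {X Y} → X ⊆ Y → collapse X ≤Learn collapse Y
      collapse-mono {X} {Y} X⊆Y = refines⇒≤Learn (collapse X) (collapse Y) λ where
          (inj₁ i≐j)       → inj₁ i≐j
          (inj₂ (Ci , Cj)) → inj₂ (Class-mono Ci , Class-mono Cj)
        where
        Class-mono : Class X ⊆ Class Y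
        Class-mono (inj₁ i≐a)            = inj₁ i≐a
        Class-mono (inj₂ (n , Xn , i≐B)) = inj₂ (n , X⊆Y Xn , i≐B)

      collapse≤E : ∀ X → collapse X ≤Learn E
      collapse≤E X = refines⇒≤Learn (collapse X) E λ where
          (inj₁ i≐j)       → extends E i≐j
          (inj₂ (Ci , Cj)) → ∼.trans (Class⊆[a] Ci) (∼.sym (Class⊆[a] Cj))
        where
        module ∼ = IsEquivalence (isEquivalence E)
        Class⊆[a] : Class X ⊆ (_∼[ E ] a)
        Class⊆[a] (inj₁ i≐a)           = extends E i≐a
        Class⊆[a] (inj₂ (n , _ , i≐B)) = ∼.trans (extends E i≐B) (B.related n)

      collapse-∅ : ∀ {X} → (∀ n → ¬ X n) → collapse X ≤Learn =ᶜᵉ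
      collapse-∅ {X} X≡∅ = refines⇒≤Learn (collapse X) =ᶜᵉ λ where
          (inj₁ i≐j)       → i≐j
          (inj₂ (Ci , Cj)) → ≐-trans (Class⊆a Ci) (≐-sym (Class⊆a Cj))
        where
        Class⊆a : ∀ {i} → Class X i → W i ≐ W a
        Class⊆a (inj₁ i≐a)          = i≐a
        Class⊆a (inj₂ (n , Xn , _)) = contradiction Xn (X≡∅ n)

      -- Local refinement at `a` applies to every `B n` with `n` at least its bound `n₀`, as
      -- `n ≤ bound n`. Since the `B n` are distinct from each other and from `W a`, `collapse Y`
      -- relates `B n` to `a` only if `Y n`.
      collapse-cancel : ∀ {X Y} → collapse X ≤Learn collapse Y →
                        Eventually (λ n → X n → Y n)
      collapse-cancel {X} {Y} X≤Y
        with n₀ , fine ← ≤Learn⇒locallyFiner (collapse X) (collapse Y) X≤Y a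
        = n₀ , λ n n₀≤n Xn → in-Y (fine (B.index n) (B.below n)
            (⊆⟨⟩-antimono {W a} {W (B.index n)} (≤-trans n₀≤n (n≤bound n)) (B.close n))
            (inj₂ (inj₂ (n , Xn , ≐-refl) , inj₁ ≐-refl)))
        where
        in-Y : ∀ {n} → B.index n ∼[ collapse Y ] a → Y n
        in-Y {n} (inj₁ B≐a)                           = contradiction B≐a (B≐̸a n)
        in-Y {n} (inj₂ (inj₁ B≐a , _))                = contradiction B≐a (B≐̸a n)
        in-Y {n} (inj₂ (inj₂ (k , Yk , Bn≐Bk) , _)) = subst Y (sym (B-injective Bn≐Bk)) Yk

      -- Finite subsets of 2^ω inside the hierarchy

      ι : FinSubset → ℛᶜᵉ
      ι P = collapse (Codes P)

      ι-mono : ∀ {P Q} → P ⊆fin Q → ι P ≤Learn ι Q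
      ι-mono P⊆Q = collapse-mono (Codes-mono P⊆Q)

      -- If `x` is not in `Q`, prefixes of some length `k₀` separate it from all of `Q`. But the
      -- code of a long enough prefix of `x` is also the code of a prefix of some `y` in `Q`.
      ι-cancel : ∀ {P Q} → ι P ≤Learn ι Q → P ⊆fin Q
      ι-cancel {P} {Q} P≤Q {x} x∈P = dne λ x∉Q →
        let n₀ , P⇒Q  = collapse-cancel {Codes P} {Codes Q} P≤Q
            k₀ , diff = separated Q x∉Q
            k         = n₀ ⊔ k₀
            y , y∈Q , l , eq = P⇒Q (code x k) (≤-trans (m≤m⊔n n₀ k₀) (k≤code x k))
                                   (x , x∈P , k , refl)
        in diff y∈Q λ i<k₀ → prefix-agree x y k l (toℕ-injective eq)
                               (≤-trans i<k₀ (m≤n⊔m n₀ k₀))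
        where
        separated : ∀ Q → ¬ (x ∈fin Q) →
                    ∃[ k ] (∀ {y} → y ∈fin Q → ¬ (∀ {i} → i < k → x i ≡ y i))
        separated []      _   = 0 , λ ()
        separated (z ∷ Q) x∉Q
          with i , xi≢zi ← dne {∃[ i ] ¬ (x i ≡ z i)} (λ none →
                 x∉Q (here λ i → dne λ xi≢zi → none (i , xi≢zi)))
             | k , diff ← separated Q (x∉Q ∘ there)
          = suc i ⊔ k , λ where
              (here y≗z)  agree → xi≢zi (trans (agree (m≤m⊔n (suc i) k)) (y≗z i))
              (there y∈Q) agree → diff y∈Q λ j<k → agree (≤-trans j<k (m≤n⊔m (suc i) k))

      ι-embedding : OrderEmbedding 𝒫fin TLH ι
      ι-embedding = record
        { isOrderHomomorphism = record
          { cong = λ (P⊆Q , Q⊆P) → ι-mono P⊆Q , ι-mono Q⊆P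
          ; mono = ι-mono
          }
        ; injective = λ (P≤Q , Q≤P) → ι-cancel P≤Q , ι-cancel Q≤P
        ; cancel    = ι-cancel
        }

      ι[]≡ : ι [] ≡Learn =ᶜᵉ
      ι[]≡ = collapse-∅ (λ { _ (_ , () , _) }) , =ᶜᵉ-minimum (ι [])

      -- If `E` were below `ι P`, so would be the image of the singleton of `diagonal P`, which
      -- would then lie in `P`.
      ι<E : ∀ P → ι P <TLH E
      ι<E P = collapse≤E (Codes P) , λ (_ , E≤ιP) →
        let d = diagonal P
        in diagonal-∉ P (ι-cancel {d ∷ []} {P}
             (≤Learn-trans {ι (d ∷ [])} {E} {ι P} (collapse≤E (Codes (d ∷ []))) E≤ιP)
             (here λ _ → refl))

    -- The embedding below `E` and atomlessness

    module _ (E : ℛᶜᵉ) (=<E : =ᶜᵉ <Learn E) where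

      private
        approximable : ∃[ a ] ∀ n → Approximation E a n
        approximable = ≰=ᶜᵉ⇒approximable E (proj₂ =<E)

      open Embedding E (proj₁ approximable) (proj₂ approximable)

      embedding : ∃[ ι ] OrderEmbedding 𝒫fin TLH ι × (ι [] ≡Learn =ᶜᵉ) ×
                         ((P : FinSubset) → (∃[ x ] x ∈fin P) → ι P <TLH E)
      embedding = ι , ι-embedding , ι[]≡ , λ P _ → ι<E P

    -- Otherwise `ι P` would be below `ι []`, and cancellation would make `P` empty.
    image-nontrivial : ∀ {ι} → OrderEmbedding 𝒫fin TLH ι → ι [] ≤Learn =ᶜᵉ →
                       ∀ {P x} → x ∈fin P → ¬ (=ᶜᵉ ≡Learn ι P)
    image-nontrivial {ι} ι-emb ι[]≤= {P} x∈P (_ , ιP≤=)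
      with () ← IsOrderMonomorphism.cancel ι-emb {P} {[]}
                  (λ 𝔎 → =ᶜᵉ-minimum (ι []) 𝔎 ∘ ιP≤= 𝔎) x∈P

    atomless : TLH-Atomless
    atomless (E , (=≤E , =≢E) , minimal) =
      let ι , ι-emb , (ι[]≤= , _) , ι<E = embedding E (=≤E , λ E≤= → =≢E (=≤E , E≤=))
          -- The image of any singleton lies strictly between the bottom and `E`.
          P = (λ _ → true) ∷ []
          x∈P = here λ _ → refl
      in minimal (ι P , (=ᶜᵉ-minimum (ι P) , image-nontrivial ι-emb ι[]≤= {P} x∈P)
                      , ι<E P (_ , x∈P))

theorem4p11 : ExcludedMiddle (lsuc 0ℓ) →
    (N : AcceptableNumbering) →
    let open TolerantLearning N in
    ((E : ℛᶜᵉ) → =ᶜᵉ <Learn E →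
    ∃[ ι ] OrderEmbedding 𝒫fin TLH ι
    × (ι [] ≡Learn =ᶜᵉ)
    × ((P : FinSubset) → (∃[ x ] x ∈fin P) → ι P <TLH E))
    × TLH-Atomless
theorem4p11 em N = embedding , atomless
  -- Excluded middle for `Set` follows from that for `Set₁` by lifting.
  where open Classical.Reducibility (map′ lower lift em) N
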